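{- Let $\mathcal{F}=\mathcal{B}(K_3)$. Then for $n\ge 3$, $$2^{n-2}(1-o(1))\le f(n,\mathcal{F})\le 2^{n-2},$$ where $o(1)\to 0$ as $n\to\infty$.
   Context: For a graph $G$, a hypergraph $H$ is a Berge-$G$ hypergraph if there are an injective map $\phi:V(G)\to V(H)$ and pairwise distinct hyperedges $e_{xy}\in E(H)$, one for each $xy\in E(G)$, with $\phi(x),\phi(y)\in e_{xy}$. $\mathcal{B}(G)$ denotes the family of all Berge-$G$ hypergraphs. For a positive integer $n$ and a graph $G$, $f(n,\mathcal{B}(G))$ is the smallest number of colors in a coloring of all subsets of $[n]=\{1,\dots,n\}$ (i.e. of $2^{[n]}$) such that there is no monochromatic Berge-$G$ hypergraph, i.e. no color class, viewed as a (non-uniform) hypergraph on $[n]$, contains a Berge-$G$ subhypergraph. -}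

module Defs where

open import Data.Bool.Base using (Bool; true; false; not)
open import Data.Bool.Properties using () renaming (_≟_ to _≟ᵇ_)
open import Data.Empty using (⊥-elim)
open import Data.Fin.Base as Fin using (Fin; zero; suc; finToFun; funToFin)
open import Data.Fin.Properties as Fin
  using (2↔Bool; all?; any?; finToFun-funToFin; ¬Fin0)
open import Data.Fin.Subset using (Subset; _∈_; ⊥)
open import Data.Fin.Subset.Properties using (anySubset?; _∈?_)
open import Data.Integer.Base using (+_)
open import Data.Nat.Base as ℕ using (ℕ; zero; suc; _≤_; _^_; z≤n; s≤s)
open import Data.Product.Base using (∃; ∃₂; _×_; _,_; proj₁; proj₂)
open import Data.Rational.Base as ℚ using (ℚ; 0ℚ; _/_)
open import Data.Vec.Base using (Vec; []; _∷_; lookup; tabulate)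
open import Data.Vec.Properties
  using (lookup∘tabulate; tabulate∘lookup; tabulate-cong; ≡-dec)
open import Function.Base using (_∘_; id)
open import Function.Bundles using (Inverse)
open import Function.Definitions using (Injective)
open import Level using (0ℓ)
open import Relation.Binary.Definitions using (DecidableEquality)
open import Relation.Binary.PropositionalEquality
  using (_≡_; _≢_; _≗_; refl; sym; trans; cong; subst)
open import Relation.Nullary.Decidable.Core
  using (Dec; yes; no; map′; _×-dec_; _→-dec_; ¬?; ⌊_⌋; recompute)
open import Relation.Nullary.Negation.Core using (¬_; contradiction)
open import Relation.Unary as U using (Pred; Decidable)

record Graph : Set where
  field
    order      : ℕ
    adj        : Fin order → Fin order → Bool
    adj-sym    : ∀ x y → adj x y ≡ adj y x
    adj-irrefl : ∀ x → adj x x ≡ false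

open Graph public

-- An unordered edge xy is represented once, by its endpoints in increasing
-- order.  The proofs are irrelevant, so edges are equal as soon as their
-- endpoints are.
record Edge (G : Graph) : Set where
  constructor edge
  field
    lo hi  : Fin (order G)
    .lo<hi : lo Fin.< hi
    .lo~hi : adj G lo hi ≡ true

open Edge public

K : ℕ → Graph
K n = record
  { order      = n
  ; adj        = λ x y → not ⌊ x Fin.≟ y ⌋
  ; adj-sym    = symmetric
  ; adj-irrefl = irreflexive
  }
  where
  symmetric : ∀ (x y : Fin n) → not ⌊ x Fin.≟ y ⌋ ≡ not ⌊ y Fin.≟ x ⌋
  symmetric x y with x Fin.≟ y | y Fin.≟ x
  ... | yes _   | yes _   = refl
  ... | no _    | no _    = refl
  ... | yes x≡y | no y≢x  = contradiction (sym x≡y) y≢x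
  ... | no x≢y  | yes y≡x = contradiction (sym y≡x) x≢y

  irreflexive : ∀ (x : Fin n) → not ⌊ x Fin.≟ x ⌋ ≡ false
  irreflexive x with x Fin.≟ x
  ... | yes _  = refl
  ... | no x≢x = contradiction refl x≢x

-- A (non-uniform) hypergraph on the vertex set Fin n, given by its set of
-- hyperedges.
Hypergraph : ℕ → Set₁
Hypergraph n = Pred (Subset n) 0ℓ

Family : Set₁
Family = ∀ {n} → Pred (Hypergraph n) 0ℓ

record IsBerge (G : Graph) {n : ℕ} (H : Hypergraph n) : Set where
  field
    φ                   : Fin (order G) → Fin n
    φ-injective         : Injective _≡_ _≡_ φ
    hyperedge           : Edge G → Subset n
    hyperedge-injective : Injective _≡_ _≡_ hyperedge
    hyperedge∈H         : ∀ e → H (hyperedge e)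
    lo∈hyperedge        : ∀ e → φ (lo e) ∈ hyperedge e
    hi∈hyperedge        : ∀ e → φ (hi e) ∈ hyperedge e

ℬ : Graph → Family
ℬ G = IsBerge G

Contains : Family → ∀ {n} → Hypergraph n → Set₁
Contains F {n} H = ∃ λ (H′ : Hypergraph n) → H′ U.⊆ H × F H′

colourClass : ∀ {n k} → (Subset n → Fin k) → Fin k → Hypergraph n
colourClass c i S = c S ≡ i

Colourable : ℕ → Family → ℕ → Set₁
Colourable n F k =
  ∃ λ (c : Subset n → Fin k) → ∀ i → ¬ Contains F (colourClass c i)

IsLeast : ∀ {ℓ} → Pred ℕ ℓ → Pred ℕ ℓ
IsLeast P m = P m × (∀ k → P k → m ≤ k)

-- If G has at most one edge and at most n vertices, then every colouring of
-- the subsets of Fin n has a monochromatic Berge-G, and f n G is undefined.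
record HasTwoEdges (G : Graph) : Set where
  field
    edge₁ edge₂ : Edge G
    edge₁≢edge₂ : edge₁ ≢ edge₂

instance
  K₃-hasTwoEdges : HasTwoEdges (K 3)
  K₃-hasTwoEdges = record
    { edge₁       = edge zero (suc zero) (s≤s z≤n) refl
    ; edge₂       = edge zero (suc (suc zero)) (s≤s z≤n) refl
    ; edge₁≢edge₂ = λ eq → contradiction (cong hi eq) λ ()
    }

-- The existence of the least number of colours is proved by exhaustive search.

private

  Searchable : Set → Set₁
  Searchable A = ∀ {P : Pred A 0ℓ} → Decidable P → Dec (∃ P)

  searchVec : ∀ {A} → Searchable A → ∀ n → Searchable (Vec A n)
  searchVec s zero    P? = map′ ([] ,_) (λ { ([] , p) → p }) (P? [])
  searchVec s (suc n) P? =
    map′ (λ (a , v , p) → a ∷ v , p) (λ { (a ∷ v , p) → a , v , p })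
         (s (λ a → searchVec s n (λ v → P? (a ∷ v))))

  _≟ˢ_ : ∀ {n} → DecidableEquality (Subset n)
  _≟ˢ_ = ≡-dec _≟ᵇ_

  module _ {G : Graph} where

    isEdge? : ∀ x y → Dec (x Fin.< y × adj G x y ≡ true)
    isEdge? x y = (x Fin.<? y) ×-dec (adj G x y ≟ᵇ true)

    allEdges? : {P : Pred (Edge G) 0ℓ} → Decidable P → Dec (∀ e → P e)
    allEdges? {P} P? =
      map′ (λ { h (edge x y p q) → h x y (recompute (x Fin.<? y) p)
                                         (recompute (adj G x y ≟ᵇ true) q) })
           (λ h x y p q → h (edge x y p q))
           (all? λ x → all? λ y → at x y (isEdge? x y))
      where
      at : ∀ x y → Dec (x Fin.< y × adj G x y ≡ true) →
           Dec (∀ (p : x Fin.< y) (q : adj G x y ≡ true) → P (edge x y p q))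
      at x y (yes (p , q)) = map′ (λ h _ _ → h) (λ h → h p q) (P? (edge x y p q))
      at x y (no ¬e)       = yes λ p q → ⊥-elim (¬e (p , q))

    _≟ᵉ_ : DecidableEquality (Edge G)
    a ≟ᵉ b = map′ (λ { (refl , refl) → refl }) (λ { refl → refl , refl })
                  ((lo a Fin.≟ lo b) ×-dec (hi a Fin.≟ hi b))

  module _ (G : Graph) {n : ℕ} where

    Witness : Hypergraph n → (Fin (order G) → Fin n) → (Edge G → Subset n) → Set
    Witness H φ h =
        (∀ x y → φ x ≡ φ y → x ≡ y)
      × (∀ a b → h a ≡ h b → a ≡ b)
      × (∀ e → H (h e) × φ (lo e) ∈ h e × φ (hi e) ∈ h e)

    witness? : ∀ {H} → Decidable H → ∀ φ h → Dec (Witness H φ h)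
    witness? H? φ h =
        (all? λ x → all? λ y → (φ x Fin.≟ φ y) →-dec (x Fin.≟ y))
      ×-dec (allEdges? λ a → allEdges? λ b → (h a ≟ˢ h b) →-dec (a ≟ᵉ b))
      ×-dec (allEdges? λ e →
               H? (h e) ×-dec (φ (lo e) ∈? h e) ×-dec (φ (hi e) ∈? h e))

    witness-resp : ∀ {H φ φ′ h h′} → φ ≗ φ′ → h ≗ h′ →
                   Witness H φ h → Witness H φ′ h′
    witness-resp {H} {φ} {φ′} {h} {h′} p q (i , j , k) =
        (λ x y r → i x y (trans (p x) (trans r (sym (p y)))))
      , (λ a b r → j a b (trans (q a) (trans r (sym (q b)))))
      , λ e → let (k₁ , k₂ , k₃) = k e in
          subst H (q e) k₁
        , transport (p (lo e)) (q e) k₂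
        , transport (p (hi e)) (q e) k₃
      where
      transport : ∀ {x y : Fin n} {S T : Subset n} → x ≡ y → S ≡ T → x ∈ S → y ∈ T
      transport refl refl x∈S = x∈S

    Table : Set
    Table = Vec (Vec (Subset n) (order G)) (order G)

    fromTable : Table → Edge G → Subset n
    fromTable t e = lookup (lookup t (lo e)) (hi e)

    entry : (Edge G → Subset n) → ∀ x y → Dec (x Fin.< y × adj G x y ≡ true) →
            Subset n
    entry h x y (yes (p , q)) = h (edge x y p q)
    entry h x y (no _)        = ⊥

    toTable : (Edge G → Subset n) → Table
    toTable h = tabulate λ x → tabulate λ y → entry h x y (isEdge? {G} x y)

    fromTable∘toTable : ∀ h → h ≗ fromTable (toTable h)
    fromTable∘toTable h (edge x y p q) = sym (trans
      (cong (λ row → lookup row y) (lookup∘tabulate _ x))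
      (trans (lookup∘tabulate _ y) (entry-edge (isEdge? {G} x y))))
      where
      entry-edge : ∀ d → entry h x y d ≡ h (edge x y p q)
      entry-edge (yes _) = refl
      entry-edge (no ¬e) = ⊥-elim (¬e ( recompute (x Fin.<? y) p
                                      , recompute (adj G x y ≟ᵇ true) q))

    isBerge? : ∀ {H : Hypergraph n} → Decidable H → Dec (IsBerge G H)
    isBerge? {H} H? = map′ to from
      (searchVec any? (order G) λ v →
       searchVec (searchVec anySubset? (order G)) (order G) λ t →
       witness? H? (lookup v) (fromTable t))
      where
      to : (∃₂ λ v t → Witness H (lookup v) (fromTable t)) → IsBerge G H
      to (v , t , i , j , k) = record
        { φ                   = lookup v
        ; φ-injective         = i _ _
        ; hyperedge           = fromTable t
        ; hyperedge-injective = j _ _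
        ; hyperedge∈H         = proj₁ ∘ k
        ; lo∈hyperedge        = proj₁ ∘ proj₂ ∘ k
        ; hi∈hyperedge        = proj₂ ∘ proj₂ ∘ k
        }
      from : IsBerge G H → ∃₂ λ v t → Witness H (lookup v) (fromTable t)
      from B = tabulate φ , toTable hyperedge ,
        witness-resp {H} (λ x → sym (lookup∘tabulate φ x))
                     (fromTable∘toTable hyperedge)
          ( (λ _ _ → φ-injective) , (λ _ _ → hyperedge-injective)
          , λ e → hyperedge∈H e , lo∈hyperedge e , hi∈hyperedge e)
        where open IsBerge B

    isBerge-mono : ∀ {H H′ : Hypergraph n} → H U.⊆ H′ → IsBerge G H → IsBerge G H′
    isBerge-mono H⊆H′ B = record
      { φ                   = φ
      ; φ-injective         = φ-injective
      ; hyperedge           = hyperedge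
      ; hyperedge-injective = hyperedge-injective
      ; hyperedge∈H         = λ e → H⊆H′ (hyperedge∈H e)
      ; lo∈hyperedge        = lo∈hyperedge
      ; hi∈hyperedge        = hi∈hyperedge
      }
      where open IsBerge B

  encode : ∀ {n} → Subset n → Fin (2 ^ n)
  encode S = funToFin (Inverse.from 2↔Bool ∘ lookup S)

  decode : ∀ {n} → Fin (2 ^ n) → Subset n
  decode {n} i = tabulate (Inverse.to 2↔Bool ∘ finToFun {2} {n} i)

  decode∘encode : ∀ {n} (S : Subset n) → decode (encode S) ≡ S
  decode∘encode S = trans
    (tabulate-cong λ i → trans
      (cong (Inverse.to 2↔Bool)
            (finToFun-funToFin (Inverse.from 2↔Bool ∘ lookup S) i))
      (Inverse.strictlyInverseˡ 2↔Bool (lookup S i)))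
    (tabulate∘lookup S)

  module _ (n : ℕ) (G : Graph) where

    colourable? : Decidable (Colourable n (ℬ G))
    colourable? k = map′ to from
      (searchVec any? (2 ^ n) λ v → all? λ i →
       ¬? (isBerge? G (λ S → lookup v (encode S) Fin.≟ i)))
      where
      good : (Subset n → Fin k) → Set
      good c = ∀ i → ¬ IsBerge G (colourClass c i)

      to : (∃ λ v → good (lookup v ∘ encode)) → Colourable n (ℬ G) k
      to (v , h) = lookup v ∘ encode ,
        λ { i (_ , H′⊆ , B) → h i (isBerge-mono G H′⊆ B) }

      from : Colourable n (ℬ G) k → ∃ λ v → good (lookup v ∘ encode)
      from (c , h) = tabulate (c ∘ decode) , λ i B →
        h i (_ , id , isBerge-mono G (λ {S} → trans (sym (same S))) B)
        where
        same : ∀ S → lookup (tabulate (c ∘ decode)) (encode S) ≡ c S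
        same S = trans (lookup∘tabulate (c ∘ decode) (encode S))
                       (cong c (decode∘encode S))

    rainbow : ⦃ HasTwoEdges G ⦄ → Colourable n (ℬ G) (2 ^ n)
    rainbow ⦃ two ⦄ = encode , λ { i (_ , H′⊆ , B) →
      let open IsBerge B
          same = trans (H′⊆ (hyperedge∈H edge₁)) (sym (H′⊆ (hyperedge∈H edge₂)))
      in edge₁≢edge₂ (hyperedge-injective
           (trans (sym (decode∘encode _)) (trans (cong decode same) (decode∘encode _)))) }
      where open HasTwoEdges two

  least : ∀ {ℓ} {P : Pred ℕ ℓ} → Decidable P → ∀ m → P m → ∃ (IsLeast P)
  least P? zero    p = zero , p , λ _ _ → z≤n
  least P? (suc m) p with P? zero
  ... | yes p₀ = zero , p₀ , λ _ _ → z≤n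
  ... | no ¬p₀ = let (k , q , min) = least (P? ∘ suc) m p in
    suc k , q , λ { zero p₀ → contradiction p₀ ¬p₀ ; (suc j) r → s≤s (min j r) }

abstract

  leastColours : ∀ n G → ⦃ HasTwoEdges G ⦄ → ∃ (IsLeast (Colourable n (ℬ G)))
  leastColours n G = least (colourable? n G) (2 ^ n) (rainbow n G)

f : (n : ℕ) (G : Graph) → ⦃ HasTwoEdges G ⦄ → ℕ
f n G = proj₁ (leastColours n G)

f-isLeast : ∀ n G → ⦃ _ : HasTwoEdges G ⦄ → IsLeast (Colourable n (ℬ G)) (f n G)
f-isLeast n G = proj₂ (leastColours n G)

ℕ→ℚ : ℕ → ℚ
ℕ→ℚ m = + m / 1

TendsToZero : (ℕ → ℚ) → Set
TendsToZero ε = ∀ δ → 0ℚ ℚ.< δ → ∃ λ N → ∀ n → N ≤ n → ℚ.∣ ε n ∣ ℚ.< δ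

{-# OPTIONS --safe #-}

-- Upper bound: group the complementary pairs {S, ∁ S} two by two.  Of any three
-- sets in such a class two are complementary, hence disjoint, whereas any two
-- hyperedges of a Berge triangle meet.
--
-- Lower bound: three distinct sets with at least three common points form a Berge
-- triangle.  Counting each point by the number d of sets containing it, and using
-- d ≤ 2 + (d choose 3), five sets of total size above 2n + 20 have three members
-- sharing three points.  So a colour class has at most four members of size above
-- (2n + 20) / 5, and by Chebyshev's inequality all but a fraction 100 / n of the
-- 2 ^ n subsets are that large.
module Submission where

open import Defs
open import Data.Nat using (ℕ; _≤_; _∸_; _^_)
open import Data.Product using (∃; _×_)
open import Data.Rational using (ℚ; 1ℚ) renaming (_*_ to _*ℚ_; _-_ to _-ℚ_; _≤_ to _≤ℚ_)

open import Data.Bool.Base using (Bool; true; false; if_then_else_; _∧_)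
open import Data.Bool.Properties using (not-injective)
open import Data.Empty using (⊥)
open import Data.Fin.Base using (Fin; zero; suc; toℕ; combine)
open import Data.Fin.Properties
  using (2↔Bool; combine-injective; suc-injective; toℕ<n; toℕ-injective)
open import Data.Fin.Subset using (Subset; _∈_; _∩_; ∁; ∣_∣)
open import Data.Fin.Subset.Properties
  using (x∈p∩q⁻; x∈∁p⇒x∉p; ∁p⊆∁q⇒p⊇q; ⊆-antisym; ⊆-reflexive)
open import Data.Integer.Base as ℤ using (+_; -[1+_]; +≤+; +<+)
import Data.Integer.Properties as ℤ
import Data.Integer.Tactic.RingSolver as ℤ-Solver
open import Data.List.Base using (List; []; _∷_; _++_; length; map; filter)
open import Data.List.Membership.Propositional.Properties using (∈-map⁻)
open import Data.List.Properties using (length-map; length-++; map-++; map-∘; map-cong)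
open import Data.List.Relation.Unary.All as All using (All; []; _∷_)
import Data.List.Relation.Unary.All.Properties as All
open import Data.List.Relation.Unary.AllPairs using ([]; _∷_)
open import Data.List.Relation.Unary.Unique.Propositional using (Unique)
import Data.List.Relation.Unary.Unique.Propositional.Properties as Unique
open import Data.Nat
  using (zero; suc; _+_; _*_; _<_; z≤n; s≤s; _≤?_; _<?_; _≟_; ∣_-_∣)
open import Data.Nat.ListAction using (sum)
open import Data.Nat.ListAction.Properties using (sum-++)
open import Data.Nat.Properties hiding (suc-injective; _≤?_; _<?_; _≟_)
open import Data.Nat.Tactic.RingSolver using (solve-∀)
open import Data.Product using (_,_; proj₁; proj₂)
import Data.Rational.Base as ℚ
import Data.Rational.Properties as ℚ
import Data.Rational.Unnormalised.Base as ℚᵘ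
import Data.Rational.Unnormalised.Properties as ℚᵘ
open import Data.Sum using (_⊎_; inj₁; inj₂)
open import Data.Vec.Base as Vec using (Vec; []; _∷_; head; tail; here; there)
open import Data.Vec.Properties using (∷-injectiveˡ; ∷-injectiveʳ)
open import Data.Vec.Relation.Unary.All as VecAll using ([]; _∷_)
open import Function.Base using (_∘_; id)
open import Function.Bundles using (Inverse)
open import Function.Definitions using (Injective)
open import Level using (0ℓ)
open import Relation.Binary.PropositionalEquality
  using (_≡_; _≢_; refl; sym; trans; cong; cong₂; subst; subst₂; module ≡-Reasoning)
open import Relation.Nullary.Decidable using (Dec; yes; no; map′; ¬?; _×-dec_; from-yes)
open import Relation.Nullary.Negation using (¬_; contradiction; contradiction-irr)
open import Relation.Unary as U using (Pred; Decidable)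

-- Counting the points of five sets through their triple intersections.

+-interchange : ∀ a b c d → (a + b) + (c + d) ≡ (a + c) + (b + d)
+-interchange = solve-∀

⟦_⟧ : Bool → ℕ
⟦ b ⟧ = if b then 1 else 0

∣∷∣ : ∀ b {n} (S : Subset n) → ∣ b ∷ S ∣ ≡ ⟦ b ⟧ + ∣ S ∣
∣∷∣ true  S = refl
∣∷∣ false S = refl

sum-∣∷∣ : ∀ {n k} (bs : Vec Bool k) (Ss : Vec (Subset n) k) →
          Vec.sum (Vec.map ∣_∣ (Vec.zipWith _∷_ bs Ss)) ≡
          Vec.sum (Vec.map ⟦_⟧ bs) + Vec.sum (Vec.map ∣_∣ Ss)
sum-∣∷∣ []       []       = refl
sum-∣∷∣ (b ∷ bs) (S ∷ Ss) = trans
  (cong₂ _+_ (∣∷∣ b S) (sum-∣∷∣ bs Ss))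
  (+-interchange ⟦ b ⟧ ∣ S ∣ (Vec.sum (Vec.map ⟦_⟧ bs)) (Vec.sum (Vec.map ∣_∣ Ss)))

-- Generic in the operation so that one list serves bits and subsets: since `_∩_` acts bitwise, the
-- `_∩_`-triples of extended sets unfold to the `_∧_`-triples of the head bits, each consed onto an
-- `_∩_`-triple of the tails.
triplesWith : {A : Set} → (A → A → A) → A → A → A → A → A → Vec A 10
triplesWith _∙_ a b c d e =
  (a ∙ (b ∙ c)) ∷ (a ∙ (b ∙ d)) ∷ (a ∙ (b ∙ e)) ∷ (a ∙ (c ∙ d)) ∷ (a ∙ (c ∙ e)) ∷
  (a ∙ (d ∙ e)) ∷ (b ∙ (c ∙ d)) ∷ (b ∙ (c ∙ e)) ∷ (b ∙ (d ∙ e)) ∷ (c ∙ (d ∙ e)) ∷ []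

allBool? : ∀ {ℓ} {P : Pred Bool ℓ} → Decidable P → Dec (∀ b → P b)
allBool? P? = map′ (λ { (p , q) true → p ; (p , q) false → q })
                   (λ h → h true , h false)
                   (P? true ×-dec P? false)

-- An element lying in d of five sets lies in d-choose-3 of the triple
-- intersections, and d ≤ 2 + d-choose-3 for every d.
degree≤2+triples : ∀ a b c d e →
  Vec.sum (Vec.map ⟦_⟧ (a ∷ b ∷ c ∷ d ∷ e ∷ [])) ≤
  2 + Vec.sum (Vec.map ⟦_⟧ (triplesWith _∧_ a b c d e))
degree≤2+triples = from-yes
  (allBool? λ a → allBool? λ b → allBool? λ c → allBool? λ d → allBool? λ e →
    Vec.sum (Vec.map ⟦_⟧ (a ∷ b ∷ c ∷ d ∷ e ∷ [])) ≤?
    2 + Vec.sum (Vec.map ⟦_⟧ (triplesWith _∧_ a b c d e)))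

-- Double counting by induction on the ground set: each point adds its degree on the left, and
-- `degree≤2+triples` pays for it with 2 and the triples containing that point.
sum-sizes≤2n+triples : ∀ {n} (A B C D E : Subset n) →
  Vec.sum (Vec.map ∣_∣ (A ∷ B ∷ C ∷ D ∷ E ∷ [])) ≤
  n * 2 + Vec.sum (Vec.map ∣_∣ (triplesWith _∩_ A B C D E))
sum-sizes≤2n+triples [] [] [] [] [] = z≤n
sum-sizes≤2n+triples {suc n} (a ∷ A) (b ∷ B) (c ∷ C) (d ∷ D) (e ∷ E) = begin
  Vec.sum (Vec.map ∣_∣ ((a ∷ A) ∷ (b ∷ B) ∷ (c ∷ C) ∷ (d ∷ D) ∷ (e ∷ E) ∷ []))
    ≡⟨ sum-∣∷∣ (a ∷ b ∷ c ∷ d ∷ e ∷ []) (A ∷ B ∷ C ∷ D ∷ E ∷ []) ⟩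
  Vec.sum (Vec.map ⟦_⟧ (a ∷ b ∷ c ∷ d ∷ e ∷ [])) + Vec.sum (Vec.map ∣_∣ (A ∷ B ∷ C ∷ D ∷ E ∷ []))
    ≤⟨ +-mono-≤ (degree≤2+triples a b c d e) (sum-sizes≤2n+triples A B C D E) ⟩
  (2 + t) + (n * 2 + T)
    ≡⟨ rearrange t (n * 2) T ⟩
  (2 + n * 2) + (t + T)
    ≡⟨ cong (_+_ (2 + n * 2)) (sum-∣∷∣ (triplesWith _∧_ a b c d e) (triplesWith _∩_ A B C D E)) ⟨
  suc n * 2 + Vec.sum (Vec.map ∣_∣ (triplesWith _∩_ (a ∷ A) (b ∷ B) (c ∷ C) (d ∷ D) (e ∷ E))) ∎
  where
  open ≤-Reasoning
  t = Vec.sum (Vec.map ⟦_⟧ (triplesWith _∧_ a b c d e))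
  T = Vec.sum (Vec.map ∣_∣ (triplesWith _∩_ A B C D E))
  rearrange : ∀ t m T → (2 + t) + (m + T) ≡ (2 + m) + (t + T)
  rearrange = solve-∀

sum≤ : ∀ {k m} {xs : Vec ℕ k} → VecAll.All (_≤ m) xs → Vec.sum xs ≤ k * m
sum≤ []       = z≤n
sum≤ (p ∷ ps) = +-mono-≤ p (sum≤ ps)

sum≥ : ∀ c {k m} {xs : Vec ℕ k} → VecAll.All (λ x → m ≤ c * x) xs → k * m ≤ c * Vec.sum xs
sum≥ c []       = z≤n
sum≥ c {xs = x ∷ xs} (p ∷ ps) =
  ≤-trans (+-mono-≤ p (sum≥ c ps)) (≤-reflexive (sym (*-distribˡ-+ c x (Vec.sum xs))))

-- Berge triangles among large sets.

elements : ∀ {n} (S : Subset n) {k} → k ≤ ∣ S ∣ →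
           ∃ λ (φ : Fin k → Fin n) → Injective _≡_ _≡_ φ × (∀ i → φ i ∈ S)
elements S {zero} _ = (λ ()) , (λ {}) , λ ()
elements (true ∷ S) {suc k} (s≤s k≤) =
  let (φ , φ-inj , φ∈) = elements S k≤ in
    (λ { zero → zero ; (suc i) → suc (φ i) })
  , (λ { {zero}  {zero}  _  → refl
       ; {suc i} {suc j} eq → cong suc (φ-inj (suc-injective eq)) })
  , λ { zero → here ; (suc i) → there (φ∈ i) }
elements (false ∷ S) {suc k} k≤ =
  let (φ , φ-inj , φ∈) = elements S k≤ in
  suc ∘ φ , φ-inj ∘ suc-injective , there ∘ φ∈

e₀₁ e₀₂ e₁₂ : Edge (K 3)
e₀₁ = edge zero (suc zero) (s≤s z≤n) refl
e₀₂ = edge zero (suc (suc zero)) (s≤s z≤n) refl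
e₁₂ = edge (suc zero) (suc (suc zero)) (s≤s (s≤s z≤n)) refl

-- Since the proofs inside an edge are irrelevant, matching on the endpoints already makes it
-- definitionally one of the three named edges.
K₃-elim : (P : Edge (K 3) → Set) → P e₀₁ → P e₀₂ → P e₁₂ → ∀ e → P e
K₃-elim P a b c (edge zero             (suc zero)       _ _) = a
K₃-elim P a b c (edge zero             (suc (suc zero)) _ _) = b
K₃-elim P a b c (edge (suc zero)       (suc (suc zero)) _ _) = c
K₃-elim P a b c (edge zero             zero             () _)
K₃-elim P a b c (edge (suc zero)       zero             () _)
K₃-elim P a b c (edge (suc zero)       (suc zero)       _ ())
K₃-elim P a b c (edge (suc (suc zero)) zero             () _)
-- Refuting 2 < 1 takes one inversion first, which an irrelevant argument does not permit in the
-- pattern.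
K₃-elim P a b c (edge (suc (suc zero)) (suc zero)       2<1 _) =
  contradiction-irr 2<1 λ { (s≤s ()) }
K₃-elim P a b c (edge (suc (suc zero)) (suc (suc zero)) _ ())

-- Three points common to all of `A`, `B`, `C` serve as the vertices; each of the sets contains
-- every vertex, so any bijection from edges to sets will do.
bergeK₃ : ∀ {n} {H : Hypergraph n} {A B C} → H A → H B → H C →
          A ≢ B → A ≢ C → B ≢ C → 3 ≤ ∣ A ∩ (B ∩ C) ∣ → IsBerge (K 3) H
bergeK₃ {n} {H} {A} {B} {C} HA HB HC A≢B A≢C B≢C 3≤ = record
  { φ                   = φ
  ; φ-injective         = proj₁ (proj₂ common)
  ; hyperedge           = h
  ; hyperedge-injective = λ {e} {e′} → h-injective e e′
  ; hyperedge∈H         = K₃-elim (H ∘ h) HA HB HC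
  ; lo∈hyperedge        = λ e → φ∈h e (lo e)
  ; hi∈hyperedge        = λ e → φ∈h e (hi e)
  }
  where
  common = elements (A ∩ (B ∩ C)) 3≤
  φ = proj₁ common

  h : Edge (K 3) → Subset n
  h = K₃-elim (λ _ → Subset n) A B C

  h-injective : ∀ e e′ → h e ≡ h e′ → e ≡ e′
  h-injective = K₃-elim (λ e → ∀ e′ → h e ≡ h e′ → e ≡ e′)
    (K₃-elim (λ e′ → A ≡ h e′ → e₀₁ ≡ e′)
      (λ _ → refl) (λ eq → contradiction eq A≢B) (λ eq → contradiction eq A≢C))
    (K₃-elim (λ e′ → B ≡ h e′ → e₀₂ ≡ e′)
      (λ eq → contradiction (sym eq) A≢B) (λ _ → refl) (λ eq → contradiction eq B≢C))
    (K₃-elim (λ e′ → C ≡ h e′ → e₁₂ ≡ e′)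
      (λ eq → contradiction (sym eq) A≢C) (λ eq → contradiction (sym eq) B≢C) (λ _ → refl))

  φ∈h : ∀ e i → φ i ∈ h e
  φ∈h e i = let (i∈A , i∈B∩C) = x∈p∩q⁻ A (B ∩ C) (proj₂ (proj₂ common) i)
                (i∈B , i∈C)   = x∈p∩q⁻ B C i∈B∩C
            in K₃-elim (λ e → φ i ∈ h e) i∈A i∈B i∈C e

-- Ten triple intersections of at most two points each allow five sets a total
-- size of 2n + 20, which is less than that of five large sets.
Large : ∀ {n} → Pred (Subset n) 0ℓ
Large {n} S = n * 2 + 20 < 5 * ∣ S ∣

large? : ∀ {n} → Decidable (Large {n})
large? S = _ <? _

berge-free⇒≤4-large : ∀ {n} {H : Hypergraph n} → ¬ IsBerge (K 3) H →
  ∀ Ss → Unique Ss → All Large Ss → All H Ss → length Ss ≤ 4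
berge-free⇒≤4-large free []                   _ _ _ = z≤n
berge-free⇒≤4-large free (_ ∷ [])             _ _ _ = s≤s z≤n
berge-free⇒≤4-large free (_ ∷ _ ∷ [])         _ _ _ = s≤s (s≤s z≤n)
berge-free⇒≤4-large free (_ ∷ _ ∷ _ ∷ [])     _ _ _ = s≤s (s≤s (s≤s z≤n))
berge-free⇒≤4-large free (_ ∷ _ ∷ _ ∷ _ ∷ []) _ _ _ = s≤s (s≤s (s≤s (s≤s z≤n)))
berge-free⇒≤4-large {n} free (A ∷ B ∷ C ∷ D ∷ E ∷ _)
  ((ab ∷ ac ∷ ad ∷ ae ∷ _) ∷ (bc ∷ bd ∷ be ∷ _) ∷ (cd ∷ ce ∷ _) ∷ (de ∷ _) ∷ _)
  (la ∷ lb ∷ lc ∷ ld ∷ le ∷ _) (a ∷ b ∷ c ∷ d ∷ e ∷ _) = contradiction large₅ (<⇒≱ few)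
  where
  open ≤-Reasoning

  sizes = Vec.map ∣_∣ (A ∷ B ∷ C ∷ D ∷ E ∷ [])

  ≤2 : ∀ {X Y Z} → _ → _ → _ → X ≢ Y → X ≢ Z → Y ≢ Z → ∣ X ∩ (Y ∩ Z) ∣ ≤ 2
  ≤2 x y z xy xz yz = ≮⇒≥ λ 3≤ → free (bergeK₃ x y z xy xz yz 3≤)

  -- Multiplied by 5 to match the definition of `Large` without division. The 21 comes from the
  -- strict inequality there: a large set has five times its size at least 2n + 21.
  few : 5 * Vec.sum sizes < 5 * (n * 2 + 21)
  few = *-monoʳ-< 5 (begin-strict
    Vec.sum sizes
      ≤⟨ sum-sizes≤2n+triples A B C D E ⟩
    n * 2 + Vec.sum (Vec.map ∣_∣ (triplesWith _∩_ A B C D E))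
      ≤⟨ +-monoʳ-≤ (n * 2) (sum≤
           ( ≤2 a b c ab ac bc ∷ ≤2 a b d ab ad bd ∷ ≤2 a b e ab ae be
           ∷ ≤2 a c d ac ad cd ∷ ≤2 a c e ac ae ce ∷ ≤2 a d e ad ae de
           ∷ ≤2 b c d bc bd cd ∷ ≤2 b c e bc be ce ∷ ≤2 b d e bd be de
           ∷ ≤2 c d e cd ce de ∷ [])) ⟩
    n * 2 + 20
      <⟨ +-monoʳ-< (n * 2) (n<1+n 20) ⟩
    n * 2 + 21 ∎)

  bound : ∀ S → Large S → n * 2 + 21 ≤ 5 * ∣ S ∣
  bound _ = ≤-trans (≤-reflexive (+-suc (n * 2) 20))

  large₅ : 5 * (n * 2 + 21) ≤ 5 * Vec.sum sizes
  large₅ = sum≥ 5 {xs = sizes}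
    (bound A la ∷ bound B lb ∷ bound C lc ∷ bound D ld ∷ bound E le ∷ [])

-- Pigeonhole over the fibres of a colouring, and the list of all subsets.

length-filter-split : ∀ {A : Set} {P : Pred A 0ℓ} (P? : Decidable P) xs →
  length xs ≡ length (filter P? xs) + length (filter (¬? ∘ P?) xs)
length-filter-split P? []       = refl
length-filter-split P? (x ∷ xs) with P? x
... | yes _ = cong suc (length-filter-split P? xs)
... | no  _ = trans (cong suc (length-filter-split P? xs)) (sym (+-suc _ _))

-- Induction on the number of values: split off the fibre over the top value `k`; the remaining
-- elements take values below `k`.
fibres≤⇒length≤ : ∀ {A : Set} {P : Pred A 0ℓ} {m} (c : A → ℕ) →
  (∀ i xs → Unique xs → All P xs → All (λ x → c x ≡ i) xs → length xs ≤ m) →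
  ∀ k xs → Unique xs → All P xs → All (λ x → c x < k) xs → length xs ≤ k * m
fibres≤⇒length≤ c fibre zero    []       _ _ _        = z≤n
fibres≤⇒length≤ c fibre zero    (x ∷ xs) _ _ (() ∷ _)
fibres≤⇒length≤ {m = m} c fibre (suc k) xs u p c<1+k = begin
  length xs
    ≡⟨ length-filter-split top? xs ⟩
  length (filter top? xs) + length (filter (¬? ∘ top?) xs)
    ≤⟨ +-mono-≤
         (fibre k _ (Unique.filter⁺ top? u) (All.filter⁺ top? p) (All.all-filter top? xs))
         (fibres≤⇒length≤ c fibre k _
           (Unique.filter⁺ (¬? ∘ top?) u) (All.filter⁺ (¬? ∘ top?) p)
           (All.zipWith (λ (lt , ne) → ≤∧≢⇒< (m<1+n⇒m≤n lt) ne)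
             (All.filter⁺ (¬? ∘ top?) c<1+k , All.all-filter (¬? ∘ top?) xs))) ⟩
  m + k * m ∎
  where
  open ≤-Reasoning
  top? : Decidable (λ x → c x ≡ k)
  top? x = c x ≟ k

subsets : ∀ n → List (Subset n)
subsets zero    = [] ∷ []
subsets (suc n) = map (true ∷_) (subsets n) ++ map (false ∷_) (subsets n)

length-subsets : ∀ n → length (subsets n) ≡ 2 ^ n
length-subsets zero    = refl
length-subsets (suc n) = begin
  length (map (true ∷_) (subsets n) ++ map (false ∷_) (subsets n))
    ≡⟨ length-++ (map (true ∷_) (subsets n)) ⟩
  length (map (true ∷_) (subsets n)) + length (map (false ∷_) (subsets n))
    ≡⟨ cong₂ _+_ (trans (length-map _ (subsets n)) (length-subsets n))
                 (trans (length-map _ (subsets n)) (length-subsets n)) ⟩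
  2 ^ n + 2 ^ n
    ≡⟨ cong (_+_ (2 ^ n)) (+-identityʳ (2 ^ n)) ⟨
  2 ^ suc n ∎
  where open ≡-Reasoning

subsets-unique : ∀ n → Unique (subsets n)
subsets-unique zero    = [] ∷ []
subsets-unique (suc n) = Unique.++⁺
  (Unique.map⁺ ∷-injectiveʳ (subsets-unique n))
  (Unique.map⁺ ∷-injectiveʳ (subsets-unique n))
  λ (∈ₜ , ∈ᶠ) → let (_ , _ , eqₜ) = ∈-map⁻ _ ∈ₜ
                    (_ , _ , eqᶠ) = ∈-map⁻ _ ∈ᶠ
                in contradiction (∷-injectiveˡ (trans (sym eqₜ) eqᶠ)) λ ()

-- Second moment of the size of a subset.

_² : ℕ → ℕ
m ² = m * m

-- Twice the distance of the size from its mean n / 2, doubled to stay within the naturals.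
deviation : ∀ {n} → Subset n → ℕ
deviation {n} S = ∣ n - (∣ S ∣ + ∣ S ∣) ∣

-- This is (x - 1)² + (x + 1)² = 2x² + 2 for x = m - k. Absolute difference strips a common
-- successor, so only the cases with a zero argument need algebra.
∣-∣²-split : ∀ m k → ∣ m - suc k ∣ ² + ∣ suc m - k ∣ ² ≡ 2 * ∣ m - k ∣ ² + 2
∣-∣²-split zero    zero    = refl
∣-∣²-split zero    (suc k) = lemma k
  where
  lemma : ∀ k → (2 + k) * (2 + k) + k * k ≡ 2 * ((1 + k) * (1 + k)) + 2
  lemma = solve-∀
∣-∣²-split (suc m) zero    rewrite ∣-∣-identityʳ m = lemma m
  where
  lemma : ∀ m → m * m + (2 + m) * (2 + m) ≡ 2 * ((1 + m) * (1 + m)) + 2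
  lemma = solve-∀
∣-∣²-split (suc m) (suc k) = ∣-∣²-split m k

-- Including the new point shifts n - 2|S| by -1 and omitting it shifts it by +1.
deviation²-split : ∀ {n} (S : Subset n) →
  deviation (true ∷ S) ² + deviation (false ∷ S) ² ≡ 2 * deviation S ² + 2
deviation²-split {n} S rewrite +-suc ∣ S ∣ ∣ S ∣ = ∣-∣²-split n (∣ S ∣ + ∣ S ∣)

module _ {A : Set} where

  sum-map-+ : ∀ (g h : A → ℕ) xs →
              sum (map g xs) + sum (map h xs) ≡ sum (map (λ x → g x + h x) xs)
  sum-map-+ g h []       = refl
  sum-map-+ g h (x ∷ xs) = trans
    (+-interchange (g x) (sum (map g xs)) (h x) (sum (map h xs)))
    (cong (_+_ (g x + h x)) (sum-map-+ g h xs))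

  sum-map-affine : ∀ a b (g : A → ℕ) xs →
                   sum (map (λ x → a * g x + b) xs) ≡ a * sum (map g xs) + length xs * b
  sum-map-affine a b g []       = lemma a
    where
    lemma : ∀ a → 0 ≡ a * 0 + 0
    lemma = solve-∀
  sum-map-affine a b g (x ∷ xs) = trans
    (cong (_+_ (a * g x + b)) (sum-map-affine a b g xs))
    (lemma a b (g x) (sum (map g xs)) (length xs))
    where
    lemma : ∀ a b y s l → (a * y + b) + (a * s + l * b) ≡ a * (y + s) + (b + l * b)
    lemma = solve-∀

  markov : ∀ {P : Pred A 0ℓ} (P? : Decidable P) {m} (g : A → ℕ) →
           (∀ x → P x → m ≤ g x) → ∀ xs → length (filter P? xs) * m ≤ sum (map g xs)
  markov P? g m≤ []       = z≤n
  markov P? g m≤ (x ∷ xs) with P? x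
  ... | yes p = +-mono-≤ (m≤ x p) (markov P? g m≤ xs)
  ... | no  _ = ≤-trans (markov P? g m≤ xs) (m≤n+m _ (g x))

-- Up to the factor 2 ^ n this is the variance n of a sum of n independent signs. Splitting on the
-- first point gives the recursion V(n + 1) = 2 V(n) + 2 · 2 ^ n.
variance : ∀ n → sum (map (λ S → deviation S ²) (subsets n)) ≡ n * 2 ^ n
variance zero    = refl
variance (suc n) = begin
  sum (map d² (map (true ∷_) Ss ++ map (false ∷_) Ss))
    ≡⟨ cong sum (map-++ d² (map (true ∷_) Ss) (map (false ∷_) Ss)) ⟩
  sum (map d² (map (true ∷_) Ss) ++ map d² (map (false ∷_) Ss))
    ≡⟨ sum-++ (map d² (map (true ∷_) Ss)) _ ⟩
  sum (map d² (map (true ∷_) Ss)) + sum (map d² (map (false ∷_) Ss))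
    ≡⟨ cong₂ (λ xs ys → sum xs + sum ys) (map-∘ Ss) (map-∘ Ss) ⟨
  sum (map (d² ∘ (true ∷_)) Ss) + sum (map (d² ∘ (false ∷_)) Ss)
    ≡⟨ sum-map-+ _ _ Ss ⟩
  sum (map (λ S → d² (true ∷ S) + d² (false ∷ S)) Ss)
    ≡⟨ cong sum (map-cong deviation²-split Ss) ⟩
  sum (map (λ S → 2 * deviation S ² + 2) Ss)
    ≡⟨ sum-map-affine 2 2 _ Ss ⟩
  2 * sum (map (λ S → deviation S ²) Ss) + length Ss * 2
    ≡⟨ cong₂ (λ v l → 2 * v + l * 2) (variance n) (length-subsets n) ⟩
  2 * (n * 2 ^ n) + 2 ^ n * 2
    ≡⟨ lemma n (2 ^ n) ⟩
  suc n * 2 ^ suc n ∎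
  where
  open ≡-Reasoning
  Ss = subsets n
  d² : Subset (suc n) → ℕ
  d² S = deviation S ²
  lemma : ∀ n x → 2 * (n * x) + x * 2 ≡ suc n * (2 * x)
  lemma = solve-∀

Small : ∀ {n} → Pred (Subset n) 0ℓ
Small S = ¬ Large S

small? : ∀ {n} → Decidable (Small {n})
small? = ¬? ∘ large?

-- If n ≥ 80 then 5 (n − 2|S|) ≥ n − 40 ≥ n / 2 for every small S.
small⇒deviates : ∀ {n} → 80 ≤ n → (S : Subset n) → Small S → n ≤ 10 * deviation S
small⇒deviates {n} 80≤n S small = +-cancelʳ-≤ (9 * n) n (10 * d) (begin
  n + 9 * n                  ≡⟨ lemma₁ n ⟩
  10 * n                     ≤⟨ *-monoʳ-≤ 10 (m≤n+∣m-n∣ n (s + s)) ⟩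
  10 * (s + s + d)           ≡⟨ lemma₂ s d ⟩
  10 * d + 4 * (5 * s)       ≤⟨ +-monoʳ-≤ (10 * d) (*-monoʳ-≤ 4 (≮⇒≥ small)) ⟩
  10 * d + 4 * (n * 2 + 20)  ≡⟨ cong (_+_ (10 * d)) (lemma₃ n) ⟩
  10 * d + (8 * n + 80)      ≤⟨ +-monoʳ-≤ (10 * d) (+-monoʳ-≤ (8 * n) 80≤n) ⟩
  10 * d + (8 * n + n)       ≡⟨ cong (_+_ (10 * d)) (lemma₄ n) ⟩
  10 * d + 9 * n             ∎)
  where
  open ≤-Reasoning
  s = ∣ S ∣
  d = deviation S
  lemma₁ : ∀ n → n + 9 * n ≡ 10 * n
  lemma₁ = solve-∀
  lemma₂ : ∀ s d → 10 * (s + s + d) ≡ 10 * d + 4 * (5 * s)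
  lemma₂ = solve-∀
  lemma₃ : ∀ n → 4 * (n * 2 + 20) ≡ 8 * n + 80
  lemma₃ = solve-∀
  lemma₄ : ∀ n → 8 * n + n ≡ 9 * n
  lemma₄ = solve-∀

-- Chebyshev's inequality: each small set has n² ≤ 100 `deviation`², and these squares sum to n 2 ^
-- n, so one factor n cancels.
small-rare : ∀ n → 80 ≤ n → n * length (filter small? (subsets n)) ≤ 100 * 2 ^ n
small-rare n@(suc _) 80≤n = *-cancelˡ-≤ n (begin
  n * (n * ℓ)
    ≡⟨ lemma₁ n ℓ ⟩
  ℓ * n ²
    ≤⟨ markov small? (λ S → 100 * deviation S ²) n²≤ (subsets n) ⟩
  sum (map (λ S → 100 * deviation S ²) (subsets n))
    ≡⟨ cong sum (map-cong (λ S → +-identityʳ _) (subsets n)) ⟨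
  sum (map (λ S → 100 * deviation S ² + 0) (subsets n))
    ≡⟨ sum-map-affine 100 0 _ (subsets n) ⟩
  100 * sum (map (λ S → deviation S ²) (subsets n)) + length (subsets n) * 0
    ≡⟨ cong₂ (λ v z → 100 * v + z) (variance n) (*-zeroʳ (length (subsets n))) ⟩
  100 * (n * 2 ^ n) + 0
    ≡⟨ lemma₂ n (2 ^ n) ⟩
  n * (100 * 2 ^ n) ∎)
  where
  open ≤-Reasoning
  ℓ = length (filter small? (subsets n))
  lemma₁ : ∀ n ℓ → n * (n * ℓ) ≡ ℓ * (n * n)
  lemma₁ = solve-∀
  lemma₂ : ∀ n x → 100 * (n * x) + 0 ≡ n * (100 * x)
  lemma₂ = solve-∀
  lemma₃ : ∀ d → (10 * d) * (10 * d) ≡ 100 * (d * d)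
  lemma₃ = solve-∀
  n²≤ : ∀ S → Small S → n ² ≤ 100 * deviation S ²
  n²≤ S small = let n≤ = small⇒deviates 80≤n S small in
    ≤-trans (*-mono-≤ n≤ n≤) (≤-reflexive (lemma₃ (deviation S)))

-- Lower bound on the number of colours.

-- This is (1 - 100 / n) 2 ^ (n - 2) ≤ k, cleared of the denominator and of subtraction. The k
-- classes hold at most 4k large sets, and the small sets number at most (100 / n) 2 ^ n.
colours-lower-bound : ∀ n k → 2 ≤ n → Colourable n (ℬ (K 3)) k →
                      n * 2 ^ (n ∸ 2) ≤ 100 * 2 ^ (n ∸ 2) + n * k
colours-lower-bound n@(suc (suc n-2)) k (s≤s (s≤s _)) (c , good) with n ≤? 100
-- Here the error term alone covers the left side.
... | yes n≤100 = ≤-trans (*-monoˡ-≤ (2 ^ n-2) n≤100) (m≤m+n _ (n * k))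
... | no  n≰100 = *-cancelˡ-≤ 4 (begin
  4 * (n * 2 ^ n-2)
    ≡⟨ lemma₁ n (2 ^ n-2) ⟩
  n * 2 ^ n
    ≡⟨ cong (n *_) (trans (sym (length-subsets n)) (length-filter-split large? (subsets n))) ⟩
  n * (length (filter large? (subsets n)) + length (filter small? (subsets n)))
    ≡⟨ *-distribˡ-+ n (length (filter large? (subsets n))) _ ⟩
  n * length (filter large? (subsets n)) + n * length (filter small? (subsets n))
    ≤⟨ +-mono-≤ (*-monoʳ-≤ n few-large) (small-rare n 80≤n) ⟩
  n * (k * 4) + 100 * 2 ^ n
    ≡⟨ lemma₂ n k (2 ^ n-2) ⟩
  4 * (100 * 2 ^ n-2 + n * k) ∎)
  where
  open ≤-Reasoning
  80≤n : 80 ≤ n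
  80≤n = ≤-trans (m≤m+n 80 20) (<⇒≤ (≰⇒> n≰100))

  fibre : ∀ i Ss → Unique Ss → All Large Ss → All (λ S → toℕ (c S) ≡ i) Ss → length Ss ≤ 4
  fibre i []         _ _ _ = z≤n
  -- The value `i` is a bare number; the colour itself is recovered from the first member of the
  -- fibre.
  fibre i Ss@(S ∷ _) u l c≡i@(cS≡i ∷ _) = berge-free⇒≤4-large
    (λ B → good (c S) (_ , id , B)) Ss u l
    (All.map (λ cT≡i → toℕ-injective (trans cT≡i (sym cS≡i))) c≡i)

  few-large : length (filter large? (subsets n)) ≤ k * 4
  few-large = fibres≤⇒length≤ (toℕ ∘ c) fibre k _
    (Unique.filter⁺ large? (subsets-unique n)) (All.all-filter large? (subsets n))
    (All.universal (λ S → toℕ<n (c S)) _)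

  lemma₁ : ∀ n x → 4 * (n * x) ≡ n * (2 * (2 * x))
  lemma₁ = solve-∀
  lemma₂ : ∀ n k x → n * (k * 4) + 100 * (2 * (2 * x)) ≡ 4 * (100 * x + n * k)
  lemma₂ = solve-∀

-- Upper bound: a colouring by pairs of complementary pairs.

index : ∀ {n} → Subset n → Fin (2 ^ n)
index []      = zero
index (b ∷ S) = combine (Inverse.from 2↔Bool b) (index S)

index-injective : ∀ {n} → Injective _≡_ _≡_ (index {n})
index-injective {x = []}    {[]}    _  = refl
index-injective {x = a ∷ S} {b ∷ T} eq =
  let (a≡b , S≡T) = combine-injective _ (index S) _ (index T) eq in
  cong₂ _∷_ (trans (sym (Inverse.strictlyInverseˡ 2↔Bool a))
                   (trans (cong (Inverse.to 2↔Bool) a≡b) (Inverse.strictlyInverseˡ 2↔Bool b)))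
            (index-injective S≡T)

∁-injective : ∀ {n} → Injective _≡_ _≡_ (∁ {n})
∁-injective ∁S≡∁T = ⊆-antisym (∁p⊆∁q⇒p⊇q (⊆-reflexive (sym ∁S≡∁T)))
                              (∁p⊆∁q⇒p⊇q (⊆-reflexive ∁S≡∁T))

-- S and its complement are the only two sets with the same fold.
fold : ∀ {n} → Subset (suc n) → Subset n
fold (true  ∷ S) = ∁ S
fold (false ∷ S) = S

-- With different heads, equal folds make the tails complementary, and the common point `x`, which
-- cannot be the head, would lie in both tails.
fold-injective-on-intersecting : ∀ {n x} {S T : Subset (suc n)} →
  x ∈ S → x ∈ T → fold S ≡ fold T → S ≡ T
fold-injective-on-intersecting {S = true ∷ S} {true ∷ T} _ _ eq =
  cong (true ∷_) (∁-injective eq)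
fold-injective-on-intersecting {S = false ∷ S} {false ∷ T} _ _ eq = cong (false ∷_) eq
fold-injective-on-intersecting {S = true ∷ S} {false ∷ _} (there x∈S) (there x∈∁S) refl =
  contradiction x∈S (x∈∁p⇒x∉p x∈∁S)
fold-injective-on-intersecting {S = false ∷ _} {true ∷ T} (there x∈∁T) (there x∈T) refl =
  contradiction x∈T (x∈∁p⇒x∉p x∈∁T)

Bool-pigeonhole : ∀ (a b c : Bool) → a ≡ b ⊎ a ≡ c ⊎ b ≡ c
Bool-pigeonhole true  true  _     = inj₁ refl
Bool-pigeonhole false false _     = inj₁ refl
Bool-pigeonhole true  false true  = inj₂ (inj₁ refl)
Bool-pigeonhole false true  false = inj₂ (inj₁ refl)
Bool-pigeonhole true  false false = inj₂ (inj₂ refl)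
Bool-pigeonhole false true  true  = inj₂ (inj₂ refl)

head-tail-injective : ∀ {A : Set} {n} {xs ys : Vec A (suc n)} →
                      head xs ≡ head ys → tail xs ≡ tail ys → xs ≡ ys
head-tail-injective {xs = _ ∷ _} {_ ∷ _} = cong₂ _∷_

-- Dropping the head bit of the fold merges two complementary pairs into each class. Two of the
-- three hyperedges of a triangle agree in that bit, hence in their fold; sharing a vertex, they
-- would be equal.
colourable-2^n : ∀ n → Colourable (suc (suc n)) (ℬ (K 3)) (2 ^ n)
colourable-2^n n = colour , λ { i (_ , H⊆ , B) → monochromatic⇒⊥ i H⊆ B }
  where
  colour : Subset (suc (suc n)) → Fin (2 ^ n)
  colour S = index (tail (fold S))

  module _ i {H : Hypergraph (suc (suc n))} (H⊆ : H U.⊆ colourClass colour i)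
           (B : IsBerge (K 3) H) where
    open IsBerge B

    first : Edge (K 3) → Bool
    first e = head (fold (hyperedge e))

    adjacent⇒≡ : ∀ {x} e e′ → x ∈ hyperedge e → x ∈ hyperedge e′ →
                 first e ≡ first e′ → e ≡ e′
    adjacent⇒≡ e e′ x∈e x∈e′ eq = hyperedge-injective
      (fold-injective-on-intersecting x∈e x∈e′ (head-tail-injective eq
        (index-injective (trans (H⊆ (hyperedge∈H e)) (sym (H⊆ (hyperedge∈H e′)))))))

    monochromatic⇒⊥ : ⊥
    monochromatic⇒⊥ with Bool-pigeonhole (first e₀₁) (first e₀₂) (first e₁₂)
    -- The shared vertices in the three cases are the images of 0, 1 and 2.
    ... | inj₁ eq        = contradiction
      (adjacent⇒≡ e₀₁ e₀₂ (lo∈hyperedge e₀₁) (lo∈hyperedge e₀₂) eq) λ ()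
    ... | inj₂ (inj₁ eq) = contradiction
      (adjacent⇒≡ e₀₁ e₁₂ (hi∈hyperedge e₀₁) (lo∈hyperedge e₁₂) eq) λ ()
    ... | inj₂ (inj₂ eq) = contradiction
      (adjacent⇒≡ e₀₂ e₁₂ (hi∈hyperedge e₀₂) (hi∈hyperedge e₁₂) eq) λ ()

-- The error term 100 / n and the passage to rationals.

ε : ℕ → ℚ
-- A default value, as 100 / 0 is undefined.
ε zero    = ℚ.0ℚ
ε (suc m) = + 100 ℚ./ suc m

-- Lets the comparisons below be made by cross-multiplication on unreduced fractions, away from
-- gcds.
toℚᵘ-/ : ∀ i m → ℚ.toℚᵘ (i ℚ./ suc m) ℚᵘ.≃ ℚᵘ.mkℚᵘ i m
toℚᵘ-/ i m = ℚ.toℚᵘ-fromℚᵘ (ℚᵘ.mkℚᵘ i m)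

ε→0 : TendsToZero ε
ε→0 (ℚ.mkℚ (+ zero)  d _) (ℚ.*<* (+<+ ()))
ε→0 (ℚ.mkℚ -[1+ _ ]  d _) (ℚ.*<* ())
-- `mkℚ` stores the denominator minus one, so δ = (p + 1) / (d + 1) ≥ 1 / (d + 1), and n > 100 (d +
-- 1) suffices.
ε→0 δ@(ℚ.mkℚ (+ suc p) d _) _ = suc (100 * suc d) , bound
  where
  bound : ∀ n → suc (100 * suc d) ≤ n → ℚ.∣ ε n ∣ ℚ.< δ
  bound (suc m) (s≤s 100d≤m) = subst (ℚ._< δ)
    (sym (ℚ.0≤p⇒∣p∣≡p (ℚ.nonNegative⁻¹ (ε (suc m)) {{ℚ.normalize-nonNeg 100 (suc m)}})))
    (ℚ.toℚᵘ-cancel-< (ℚᵘ.<-respˡ-≃ (ℚᵘ.≃-sym (toℚᵘ-/ (+ 100) m)) (ℚᵘ.*<* (+<+ 100d<pn))))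
    where
    100d<pn : 100 * suc d < suc p * suc m
    100d<pn = <-≤-trans (s≤s 100d≤m) (m≤n*m (suc m) (suc p))

-- Stated over the integers because n - 100 may be negative.
ℤ-bound : ∀ n a k → n * a ≤ 100 * a + n * k →
          + a ℤ.* (+ n ℤ.- + 100) ℤ.≤ + k ℤ.* + n
ℤ-bound n a k na≤ = begin
  + a ℤ.* (+ n ℤ.- + 100)
    ≡⟨ expand (+ n) (+ a) ⟩
  + n ℤ.* + a ℤ.- + 100 ℤ.* + a
    ≡⟨ cong (ℤ._- + 100 ℤ.* + a) (ℤ.pos-* n a) ⟨
  + (n * a) ℤ.- + 100 ℤ.* + a
    ≤⟨ ℤ.+-monoˡ-≤ (ℤ.- (+ 100 ℤ.* + a)) (+≤+ na≤) ⟩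
  + (100 * a + n * k) ℤ.- + 100 ℤ.* + a
    ≡⟨ cong (ℤ._- + 100 ℤ.* + a) (cong₂ ℤ._+_ (ℤ.pos-* 100 a) (ℤ.pos-* n k)) ⟩
  (+ 100 ℤ.* + a ℤ.+ + n ℤ.* + k) ℤ.- + 100 ℤ.* + a
    ≡⟨ cancel (+ n) (+ a) (+ k) ⟩
  + k ℤ.* + n ∎
  where
  open ℤ.≤-Reasoning
  expand : ∀ n a → a ℤ.* (n ℤ.- + 100) ≡ n ℤ.* a ℤ.- + 100 ℤ.* a
  expand = ℤ-Solver.solve-∀
  cancel : ∀ n a k → (+ 100 ℤ.* a ℤ.+ n ℤ.* k) ℤ.- + 100 ℤ.* a ≡ k ℤ.* n
  cancel = ℤ-Solver.solve-∀

a[1-ε]≤k : ∀ m a k → suc m * a ≤ 100 * a + suc m * k →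
           ℕ→ℚ a *ℚ (1ℚ -ℚ ε (suc m)) ≤ℚ ℕ→ℚ k
a[1-ε]≤k m a k na≤ = ℚ.toℚᵘ-cancel-≤ (begin
  ℚ.toℚᵘ (ℕ→ℚ a *ℚ (1ℚ -ℚ ε (suc m)))
    ≃⟨ ℚ.toℚᵘ-homo-* (ℕ→ℚ a) (1ℚ -ℚ ε (suc m)) ⟩
  ℚ.toℚᵘ (ℕ→ℚ a) ℚᵘ.* ℚ.toℚᵘ (1ℚ -ℚ ε (suc m))
    ≃⟨ ℚᵘ.*-cong (toℚᵘ-/ (+ a) 0) (ℚᵘ.≃-trans (ℚ.toℚᵘ-homo-+ 1ℚ (ℚ.- ε (suc m)))
         (ℚᵘ.+-congʳ (ℚ.toℚᵘ 1ℚ) (ℚᵘ.≃-trans (ℚ.toℚᵘ-homo‿- (ε (suc m)))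
           (ℚᵘ.-‿cong (toℚᵘ-/ (+ 100) m))))) ⟩
  ℚᵘ.mkℚᵘ (+ a) 0 ℚᵘ.* (ℚᵘ.1ℚᵘ ℚᵘ.- ℚᵘ.mkℚᵘ (+ 100) m)
    ≤⟨ ℚᵘ.*≤* (subst₂ ℤ._≤_ (lhs (+ suc m) (+ a)) (rhs (+ suc m) (+ k)) (ℤ-bound (suc m) a k na≤)) ⟩
  ℚᵘ.mkℚᵘ (+ k) 0
    ≃⟨ toℚᵘ-/ (+ k) 0 ⟨
  ℚ.toℚᵘ (ℕ→ℚ k) ∎)
  where
  open ℚᵘ.≤-Reasoning
  -- The right sides of `lhs` and `rhs` are the cross products to which the unnormalised inequality
  -- unfolds.
  lhs : ∀ n a → a ℤ.* (n ℤ.- + 100) ≡ (a ℤ.* (+ 1 ℤ.* n ℤ.+ (ℤ.- + 100) ℤ.* + 1)) ℤ.* + 1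
  lhs = ℤ-Solver.solve-∀
  rhs : ∀ n k → k ℤ.* n ≡ k ℤ.* (+ 1 ℤ.* (+ 1 ℤ.* n))
  rhs = ℤ-Solver.solve-∀

theorem1 : ∃ λ (ε : ℕ → ℚ) →
    TendsToZero ε ×
    (∀ n → 3 ≤ n →
    (ℕ→ℚ (2 ^ (n ∸ 2)) *ℚ (1ℚ -ℚ ε n) ≤ℚ ℕ→ℚ (f n (K 3))) ×
    (f n (K 3) ≤ 2 ^ (n ∸ 2)))
theorem1 = ε , ε→0 , bounds
  where
  bounds : ∀ n → 3 ≤ n → (ℕ→ℚ (2 ^ (n ∸ 2)) *ℚ (1ℚ -ℚ ε n) ≤ℚ ℕ→ℚ (f n (K 3))) ×
                         (f n (K 3) ≤ 2 ^ (n ∸ 2))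
  bounds n@(suc (suc m)) (s≤s (s≤s _)) =
    let (colourable , minimal) = f-isLeast n (K 3) in
      a[1-ε]≤k (suc m) (2 ^ m) (f n (K 3))
        (colours-lower-bound n (f n (K 3)) (s≤s (s≤s z≤n)) colourable)
    , minimal (2 ^ m) (colourable-2^n m)
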